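{- Let $G=(V,E)$ be a finite undirected graph, let $\tau:\mathbb{Z}_+\to\mathbb{Z}_+$ be a non-increasing function, and let $\pi:2^V\to\mathbb{R}_+$ be a monotone function, i.e., $\pi(T)\le\pi(S)$ if $T\subseteq S$. Consider CR-$f$-NDP, where the base cut-requirement function $f$ is given by $f(S):=\min\{\ell\in\mathbb{Z}_+:\tau(\ell)<\pi(S)\}$ for all $\emptyset\ne S\subseteq V$. Then (a) $f$ is weakly supermodular; (b) $H\subseteq E$ is feasible for CR-$f$-NDP if and only if for every fault-set $F\subseteq E$, and every $S\subseteq V$ with $\pi(S)\le\tau(|F|)$, $S$ is (the node-set of) a component of $G-F$ if and only if it is (the node-set of) a component of $H-F$.
   Context: For $S\subseteq V$ and $Z\subseteq E$, $\delta_G(S)$ is the set of edges of $G$ with exactly one end in $S$ and $\delta_Z(S)=\delta_G(S)\cap Z$. An edge set $H\subseteq E$ is identified with the spanning subgraph $(V,H)$; $G-F$ and $H-F$ denote $(V,E\setminus F)$ and $(V,H\setminus F)$; components are connected components. A function $f$ on $2^V$ is weakly supermodular if for all $A,B\subseteq V$, $f(A)+f(B)\le\max\{f(A\cap B)+f(A\cup B),\ f(A-B)+f(B-A)\}$. For such a function $f$, $H\subseteq E$ is feasible for CR-$f$-NDP (cut-relative $f$-network design) if $|\delta_H(S)|\ge\min\{f(S),|\delta_G(S)|\}$ for all $S\subseteq V$. Conventions: $\min\emptyset=+\infty$ (so $f$ may take the value $+\infty$), and $f(\emptyset)=0$. -}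

module Defs where

open import Axiom.ExcludedMiddle using (ExcludedMiddle)
open import Data.Bool using (_xor_)
open import Data.Fin using (Fin)
open import Data.Fin.Subset using (Subset; _∈_; _∩_; _∪_; _─_; ∣_∣; ⊥; Nonempty)
open import Data.Fin.Subset.Properties using (nonempty?; ∉⊥)
open import Data.Integer as ℤ using ()
open import Data.Nat using (ℕ; _+_; _≤_; _<_; _⊔_; _⊓_)
open import Data.Nat.Induction using (<-rec)
open import Data.Nat.Properties using (≮⇒≥; ≤-antisym; anyUpTo?)
open import Data.Product using (_×_; _,_; ∃; ∃-syntax; proj₁; proj₂)
open import Data.Rational as ℚ using (ℚ)
import Data.Rational.Properties as ℚₚ
open import Data.Sum using (_⊎_; inj₁; inj₂)
open import Data.Vec using (lookup; tabulate)
open import Function using (_⇔_)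
open import Level using (0ℓ)
open import Relation.Binary.Construct.Add.Supremum.NonStrict _≤_ using (_≤⁺_)
open import Relation.Binary.Construct.Closure.ReflexiveTransitive using (Star)
open import Relation.Binary.PropositionalEquality using (_≡_; refl; subst; cong)
open import Relation.Nullary using (¬_; yes; no; contradiction)
open import Relation.Nullary.Construct.Add.Supremum using (_⁺; ⊤⁺; [_])

-- Two-sided Dedekind cuts of ℚ.
record ℝ : Set₁ where
  field
    Lower         : ℚ → Set          -- Lower q means q < x
    Upper         : ℚ → Set          -- Upper q means x < q
    lower-inhab   : ∃ Lower
    upper-inhab   : ∃ Upper
    lower-closed  : ∀ {p q} → p ℚ.< q → Lower q → Lower p
    upper-closed  : ∀ {p q} → p ℚ.< q → Upper p → Upper q
    lower-open    : ∀ {p} → Lower p → ∃[ q ] (p ℚ.< q × Lower q)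
    upper-open    : ∀ {q} → Upper q → ∃[ p ] (p ℚ.< q × Upper p)
    disjoint      : ∀ {q} → ¬ (Lower q × Upper q)
    located       : ∀ {p q} → p ℚ.< q → Lower p ⊎ Upper q

open ℝ

infix 4 _<ℝ_ _≤ℝ_

_<ℝ_ : ℝ → ℝ → Set
x <ℝ y = ∃[ q ] (Upper x q × Lower y q)

_≤ℝ_ : ℝ → ℝ → Set
x ≤ℝ y = ∀ q → Lower x q → Lower y q

fromℚ : ℚ → ℝ
fromℚ r = record
  { Lower        = ℚ._< r
  ; Upper        = r ℚ.<_
  ; lower-inhab  = r ℚ.- ℚ.1ℚ ,
      subst (r ℚ.- ℚ.1ℚ ℚ.<_) (ℚₚ.+-identityʳ r)
            (ℚₚ.+-monoʳ-< r (ℚₚ.negative⁻¹ (ℚ.- ℚ.1ℚ)))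
  ; upper-inhab  = r ℚ.+ ℚ.1ℚ ,
      subst (ℚ._< r ℚ.+ ℚ.1ℚ) (ℚₚ.+-identityʳ r)
            (ℚₚ.+-monoʳ-< r (ℚₚ.positive⁻¹ ℚ.1ℚ))
  ; lower-closed = ℚₚ.<-trans
  ; upper-closed = λ p<q r<p → ℚₚ.<-trans r<p p<q
  ; lower-open   = ℚₚ.<-dense
  ; upper-open   = λ r<q → let p , r<p , p<q = ℚₚ.<-dense r<q in p , p<q , r<p
  ; disjoint     = λ (q<r , r<q) → ℚₚ.<-asym q<r r<q
  ; located      = λ {p} {q} → located′ p q
  }
  where
  located′ : ∀ p q → p ℚ.< q → p ℚ.< r ⊎ r ℚ.< q
  located′ p q p<q with p ℚₚ.<? r
  ... | yes p<r = inj₁ p<r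
  ... | no  p≮r = inj₂ (ℚₚ.≤-<-trans (ℚₚ.≮⇒≥ p≮r) p<q)

fromℕ : ℕ → ℝ
fromℕ k = fromℚ (ℤ.+ k ℚ./ 1)

-- ℕ ∪ {+∞} is ℕ ⁺ with the order _≤⁺_, where ⊤⁺ is +∞.
infixl 6 _+⁺_ _⊔⁺_
infixl 7 _⊓⁺_

_+⁺_ : ℕ ⁺ → ℕ ⁺ → ℕ ⁺
[ a ] +⁺ [ b ] = [ a + b ]
[ _ ] +⁺ ⊤⁺    = ⊤⁺
⊤⁺    +⁺ _     = ⊤⁺

_⊔⁺_ : ℕ ⁺ → ℕ ⁺ → ℕ ⁺
[ a ] ⊔⁺ [ b ] = [ a ⊔ b ]
[ _ ] ⊔⁺ ⊤⁺    = ⊤⁺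
⊤⁺    ⊔⁺ _     = ⊤⁺

_⊓⁺_ : ℕ ⁺ → ℕ ⁺ → ℕ ⁺
[ a ] ⊓⁺ [ b ] = [ a ⊓ b ]
[ a ] ⊓⁺ ⊤⁺    = [ a ]
⊤⁺    ⊓⁺ y     = y

-- IsMin P m : m is the minimum of {ℓ ∣ P ℓ}, where min ∅ = +∞.
IsMin : (ℕ → Set) → ℕ ⁺ → Set
IsMin P [ k ] = P k × (∀ ℓ → P ℓ → k ≤ ℓ)
IsMin P ⊤⁺    = ∀ ℓ → ¬ P ℓ

-- Vertex set Fin n, edge set Fin m. The order of the two ends of an edge
-- carries no meaning; parallel edges and loops are allowed.
record Graph : Set where
  field
    n m  : ℕ
    ends : Fin m → Fin n × Fin n

  VertexSet EdgeSet : Set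
  VertexSet = Subset n
  EdgeSet   = Subset m

module _ (G : Graph) where
  open Graph G

  δ : VertexSet → EdgeSet
  δ S = tabulate λ e →
    lookup S (proj₁ (ends e)) xor lookup S (proj₂ (ends e))

  δ[_] : EdgeSet → VertexSet → EdgeSet
  δ[ Z ] S = δ S ∩ Z

  Adjacent : EdgeSet → Fin n → Fin n → Set
  Adjacent Z u v = ∃[ e ] (e ∈ Z × (ends e ≡ (u , v) ⊎ ends e ≡ (v , u)))

  Connected : EdgeSet → Fin n → Fin n → Set
  Connected Z = Star (Adjacent Z)

  -- S is the node set of a connected component of the spanning subgraph
  -- (V , Z), that is, a class of the equivalence relation Connected Z.
  IsComponent : EdgeSet → VertexSet → Set
  IsComponent Z S = ∃[ u ] (∀ v → v ∈ S ⇔ Connected Z u v)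

  Feasible : (VertexSet → ℕ ⁺) → EdgeSet → Set
  Feasible f H = ∀ S → f S ⊓⁺ [ ∣ δ S ∣ ] ≤⁺ [ ∣ δ[ H ] S ∣ ]

WeaklySupermodular : ∀ {n} → (Subset n → ℕ ⁺) → Set
WeaklySupermodular f = ∀ A B →
  f A +⁺ f B ≤⁺ (f (A ∩ B) +⁺ f (A ∪ B)) ⊔⁺ (f (A ─ B) +⁺ f (B ─ A))

-- f is the function S ↦ min {ℓ ∣ τ ℓ < π S} for S ≠ ∅, with f ∅ = 0.
-- It is specified by a predicate because this minimum is not computable
-- from τ and π: whether the set is empty is undecidable in general.
-- The lemmas below show that f is unique, and that it exists classically.
record IsBaseCutRequirement {n} (τ : ℕ → ℕ) (π : Subset n → ℝ)
                            (f : Subset n → ℕ ⁺) : Set where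
  field
    at-empty    : f ⊥ ≡ [ 0 ]
    at-nonempty : ∀ S → Nonempty S → IsMin (λ ℓ → fromℕ (τ ℓ) <ℝ π S) (f S)

IsMin-unique : ∀ {P} x y → IsMin P x → IsMin P y → x ≡ y
IsMin-unique [ k ] [ l ] (pk , k≤) (pl , l≤) = cong [_] (≤-antisym (k≤ l pl) (l≤ k pk))
IsMin-unique [ k ] ⊤⁺    (pk , _)  ¬p        = contradiction pk (¬p k)
IsMin-unique ⊤⁺    [ l ] ¬p        (pl , _)  = contradiction pl (¬p l)
IsMin-unique ⊤⁺    ⊤⁺    _         _         = refl

IsMin-exists : ExcludedMiddle 0ℓ → ∀ P → ∃ (IsMin P)
IsMin-exists em P with em {∃ P}
... | no  ¬∃P     = ⊤⁺ , λ ℓ p → ¬∃P (ℓ , p)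
... | yes (ℓ , p) = <-rec (λ ℓ → P ℓ → ∃ (IsMin P)) step ℓ p
  where
  step : ∀ ℓ → (∀ {k} → k < ℓ → P k → ∃ (IsMin P)) → P ℓ → ∃ (IsMin P)
  step ℓ rec p with anyUpTo? (λ k → em {P k}) ℓ
  ... | yes (k , k<ℓ , pk) = rec k<ℓ pk
  ... | no  none           = [ ℓ ] , p , λ k pk → ≮⇒≥ λ k<ℓ → none (k , k<ℓ , pk)

baseCutRequirement-exists : ExcludedMiddle 0ℓ → ∀ {n} (τ : ℕ → ℕ) (π : Subset n → ℝ) →
                            ∃ (IsBaseCutRequirement τ π)
baseCutRequirement-exists em {n} τ π = f , record
  { at-empty = f-empty ; at-nonempty = f-nonempty }
  where
  m : ∀ S → ∃ (IsMin (λ ℓ → fromℕ (τ ℓ) <ℝ π S))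
  m S = IsMin-exists em _

  f : Subset n → ℕ ⁺
  f S with nonempty? S
  ... | yes _ = proj₁ (m S)
  ... | no  _ = [ 0 ]

  f-empty : f ⊥ ≡ [ 0 ]
  f-empty with nonempty? {n} ⊥
  ... | yes (_ , x∈⊥) = contradiction x∈⊥ ∉⊥
  ... | no  _         = refl

  f-nonempty : ∀ S → Nonempty S → IsMin (λ ℓ → fromℕ (τ ℓ) <ℝ π S) (f S)
  f-nonempty S S≠∅ with nonempty? S
  ... | yes _   = proj₂ (m S)
  ... | no  S=∅ = contradiction S≠∅ S=∅

{-# OPTIONS --safe #-}
-- Since π is monotone and τ non-increasing, f is antitone on nonempty sets. If A and B are not
-- nested, this bounds f A + f B by f (A ─ B) + f (B ─ A); for nested sets A ∩ B and A ∪ B are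
-- A and B themselves.
--
-- For nonempty S, π S ≤ τ ∣F∣ says exactly that f S > ∣F∣. If H is feasible and S is closed in
-- H - F, then ∣δ_H(S)∣ ≤ ∣F∣ < f S forces δ_H(S) = δ_G(S), so S is closed in G - F as well; this
-- transfers components both ways, because H - F is a subgraph of G - F. Conversely, if
-- feasibility fails at S, take F = δ_H(S) and an edge of δ_G(S) outside F: the component of H - F
-- at the end of that edge in S stays inside S and is not a component of G - F.
module Submission where

open import Defs
open import Data.Bool using (true; false; _xor_)
open import Data.Fin using (Fin)
open import Data.Fin.Subset
  using (Subset; _∈_; _∉_; _⊆_; _⊃_; _∩_; _∪_; _─_; ∣_∣; ⊤; ⁅_⁆; inside; outside; Nonempty; Empty)
open import Data.Fin.Subset.Induction using (⊃-wellFounded)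
open import Data.Fin.Subset.Properties
  using (_∈?_; nonempty?; ∈⊤; x∈⁅x⁆; x∈⁅y⁆⇒x≡y; ⊆-antisym; p⊆q⇒∣p∣≤∣q∣; p⊂q⇒∣p∣<∣q∣; p∩q⊆p; p∩q⊆q;
         x∈p∩q⁺; x∈p∩q⁻; p⊆p∪q; q⊆p∪q; x∈p∪q⁻; x∈p∧x∉q⇒x∈p─q; p─q⊆p)
open import Data.Integer using (+_)
import Data.Integer as ℤ
import Data.Integer.Properties as ℤₚ
open import Data.Nat using (ℕ; _≤_; _≤?_)
open import Data.Nat.Coprimality using (1-coprimeTo) renaming (sym to coprime-sym)
open import Data.Nat.Properties
  using (≤-refl; ≤-trans; <⇒≱; +-mono-≤; +-comm; m≤m⊔n; m≤n⊔m; ⊓-sel; m⊓n≤m; m⊓n≤n)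
open import Data.Product using (_×_; _,_; ∃-syntax; proj₁; proj₂)
import Data.Rational as ℚ
import Data.Rational.Properties as ℚₚ
open import Data.Sum using (_⊎_; inj₁; inj₂; [_,_]′)
open import Data.Vec using (lookup; here; there; _∷_)
open import Data.Vec.Properties using ([]=⇒lookup; lookup⇒[]=; lookup∘tabulate)
open import Function using (_⇔_; mk⇔; Equivalence; _∘_)
open import Induction.WellFounded using (Acc; acc)
open import Relation.Binary.Construct.Add.Supremum.NonStrict _≤_
  using (_≤⁺_; [_]; _≤⊤⁺; ≤⁺-trans; ≤⁺-dec; ≤⁺-reflexive-≡)
open import Relation.Binary.Construct.Closure.ReflexiveTransitive as Star using (ε; _◅_; _◅◅_)
open import Relation.Binary.PropositionalEquality
  using (_≡_; refl; sym; trans; cong)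
open import Relation.Nullary using (¬_; yes; no; contradiction)
open import Relation.Nullary.Construct.Add.Supremum using (_⁺; ⊤⁺; [_])

open Equivalence using (to; from)
open ℝ

-- Order on cuts

≤ℝ-trans : ∀ x y z → x ≤ℝ y → y ≤ℝ z → x ≤ℝ z
≤ℝ-trans x y z x≤y y≤z q = y≤z q ∘ x≤y q

<-≤ℝ-trans : ∀ x y z → x <ℝ y → y ≤ℝ z → x <ℝ z
<-≤ℝ-trans x y z (q , x<q , q<y) y≤z = q , x<q , y≤z q q<y

≤ℝ⇒≯ℝ : ∀ x y → x ≤ℝ y → ¬ y <ℝ x
≤ℝ⇒≯ℝ x y x≤y (q , y<q , q<x) = disjoint y (x≤y q q<x , y<q)

-- Locatedness of `y` replaces trichotomy: openness moves a rational `p` below `x` up to some `q`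
-- still below `x`, and placing `y` above `p` or below `q` settles the claim, since `y` below `q`
-- would give `y <ℝ x`.
≯ℝ⇒≤ℝ : ∀ x y → ¬ y <ℝ x → x ≤ℝ y
≯ℝ⇒≤ℝ x y y≮x p p<x with lower-open x p<x
... | q , p<q , q<x with located y p<q
...   | inj₁ p<y = p<y
...   | inj₂ y<q = contradiction (q , y<q , q<x) y≮x

/1-mono-≤ : ∀ {a b} → a ≤ b → + a ℚ./ 1 ℚ.≤ + b ℚ./ 1
/1-mono-≤ {a} {b} a≤b
  -- `ℚ./` divides by a gcd that does not reduce for a variable numerator; coprimality with 1
  -- rewrites both sides to fractions in lowest terms.
  rewrite ℚₚ.normalize-coprime {a} {0} (coprime-sym (1-coprimeTo a))
        | ℚₚ.normalize-coprime {b} {0} (coprime-sym (1-coprimeTo b))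
  = ℚ.*≤* (ℤₚ.*-monoʳ-≤-nonNeg (+ 1) (ℤ.+≤+ a≤b))

fromℕ-≤-<ℝ-trans : ∀ {a b} y → a ≤ b → fromℕ b <ℝ y → fromℕ a <ℝ y
fromℕ-≤-<ℝ-trans y a≤b (q , b<q , q<y) = q , ℚₚ.≤-<-trans (/1-mono-≤ a≤b) b<q , q<y

-- Arithmetic of ℕ ∪ {+∞}

≤⁺-refl : ∀ {x} → x ≤⁺ x
≤⁺-refl = ≤⁺-reflexive-≡ (λ { refl → ≤-refl }) refl

+⁺-comm : ∀ x y → x +⁺ y ≡ y +⁺ x
+⁺-comm [ a ] [ b ] = cong [_] (+-comm a b)
+⁺-comm [ _ ] ⊤⁺    = refl
+⁺-comm ⊤⁺    [ _ ] = refl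
+⁺-comm ⊤⁺    ⊤⁺    = refl

+⁺-mono-≤⁺ : ∀ {x x′ y y′} → x ≤⁺ x′ → y ≤⁺ y′ → x +⁺ y ≤⁺ x′ +⁺ y′
+⁺-mono-≤⁺ [ p ]    [ q ]    = [ +-mono-≤ p q ]
+⁺-mono-≤⁺ [ p ]    (_ ≤⊤⁺)  = _ ≤⊤⁺
+⁺-mono-≤⁺ (_ ≤⊤⁺)  _        = _ ≤⊤⁺

x≤x⊔⁺y : ∀ x y → x ≤⁺ x ⊔⁺ y
x≤x⊔⁺y [ a ] [ b ] = [ m≤m⊔n a b ]
x≤x⊔⁺y [ _ ] ⊤⁺    = _ ≤⊤⁺
x≤x⊔⁺y ⊤⁺    _     = _ ≤⊤⁺

y≤x⊔⁺y : ∀ x y → y ≤⁺ x ⊔⁺ y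
y≤x⊔⁺y [ a ] [ b ] = [ m≤n⊔m a b ]
y≤x⊔⁺y [ _ ] ⊤⁺    = _ ≤⊤⁺
y≤x⊔⁺y ⊤⁺    _     = _ ≤⊤⁺

x⊓⁺y≤x : ∀ x y → x ⊓⁺ y ≤⁺ x
x⊓⁺y≤x [ a ] [ b ] = [ m⊓n≤m a b ]
x⊓⁺y≤x [ _ ] ⊤⁺    = ≤⁺-refl
x⊓⁺y≤x ⊤⁺    _     = _ ≤⊤⁺

x⊓⁺y≤y : ∀ x y → x ⊓⁺ y ≤⁺ y
x⊓⁺y≤y [ a ] [ b ] = [ m⊓n≤n a b ]
x⊓⁺y≤y [ _ ] ⊤⁺    = _ ≤⊤⁺
x⊓⁺y≤y ⊤⁺    _     = ≤⁺-refl

⊓⁺-sel : ∀ x y → x ⊓⁺ y ≡ x ⊎ x ⊓⁺ y ≡ y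
⊓⁺-sel [ a ] [ b ] = [ inj₁ ∘ cong [_] , inj₂ ∘ cong [_] ]′ (⊓-sel a b)
⊓⁺-sel [ _ ] ⊤⁺    = inj₁ refl
⊓⁺-sel ⊤⁺    _     = inj₂ refl

-- Minima

IsMin-≤ : ∀ {P x ℓ} → IsMin P x → P ℓ → x ≤⁺ [ ℓ ]
IsMin-≤ {x = [ _ ]} (_ , least) p = [ least _ p ]
IsMin-≤ {x = ⊤⁺}    none        p = contradiction p (none _)

IsMin-anti : ∀ {P Q x y} → (∀ {ℓ} → Q ℓ → P ℓ) → IsMin P x → IsMin Q y → x ≤⁺ y
IsMin-anti {y = [ _ ]} Q⇒P minP (q , _) = IsMin-≤ minP (Q⇒P q)
IsMin-anti {y = ⊤⁺}    _   _    _       = _ ≤⊤⁺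

-- For an upward closed `P` the minimum decides membership: together with `IsMin-≤`, `P ℓ` amounts
-- to `x ≤⁺ [ ℓ ]`. The last hypothesis excludes `⊤⁺`.
IsMin-≤⁻ : ∀ {P x ℓ} → (∀ {j k} → j ≤ k → P j → P k) → IsMin P x → x ≤⁺ [ ℓ ] → P ℓ
IsMin-≤⁻ up (p , _) [ k≤ℓ ] = up k≤ℓ p

-- Finite subsets

x∈p─q⇒x∉q : ∀ {n x} (p q : Subset n) → x ∈ p ─ q → x ∉ q
x∈p─q⇒x∉q (_ ∷ p) (inside  ∷ q) ()         here
x∈p─q⇒x∉q (_ ∷ p) (_       ∷ q) (there x∈) (there x∈q) = x∈p─q⇒x∉q p q x∈ x∈q

∉⇒lookup≡outside : ∀ {n x} {S : Subset n} → x ∉ S → lookup S x ≡ outside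
∉⇒lookup≡outside {x = x} {S} x∉S with lookup S x in eq
... | true  = contradiction (lookup⇒[]= x S eq) x∉S
... | false = refl

lookup≡outside⇒∉ : ∀ {n x} {S : Subset n} → lookup S x ≡ outside → x ∉ S
lookup≡outside⇒∉ eq x∈S with () ← trans (sym ([]=⇒lookup x∈S)) eq

module _ {n : ℕ} where

  ─-monoˡ-⊆ : ∀ {p q : Subset n} r → p ⊆ q → p ─ r ⊆ q ─ r
  ─-monoˡ-⊆ {p} r p⊆q x∈ = x∈p∧x∉q⇒x∈p─q (p⊆q (p─q⊆p p r x∈)) (x∈p─q⇒x∉q p r x∈)

  Empty-─⇒⊆ : ∀ {p q : Subset n} → Empty (p ─ q) → p ⊆ q
  Empty-─⇒⊆ {q = q} empty {x} x∈p with x ∈? q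
  ... | yes x∈q = x∈q
  ... | no  x∉q = contradiction (x , x∈p∧x∉q⇒x∈p─q x∈p x∉q) empty

  ∣p∣≰∣q∣⇒Nonempty-─ : ∀ {p q : Subset n} → ¬ ∣ p ∣ ≤ ∣ q ∣ → Nonempty (p ─ q)
  ∣p∣≰∣q∣⇒Nonempty-─ {p} {q} ∣p∣≰∣q∣ with nonempty? (p ─ q)
  ... | yes nonempty = nonempty
  ... | no  empty    = contradiction (p⊆q⇒∣p∣≤∣q∣ (Empty-─⇒⊆ empty)) ∣p∣≰∣q∣

  p⊆q∧∣q∣≤∣p∣⇒q⊆p : ∀ {p q : Subset n} → p ⊆ q → ∣ q ∣ ≤ ∣ p ∣ → q ⊆ p
  p⊆q∧∣q∣≤∣p∣⇒q⊆p {p} p⊆q ∣q∣≤∣p∣ {x} x∈q with x ∈? p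
  ... | yes x∈p = x∈p
  ... | no  x∉p = contradiction ∣q∣≤∣p∣ (<⇒≱ (p⊂q⇒∣p∣<∣q∣ (p⊆q , x , x∈q , x∉p)))

  p⊆q⇒p∩q≡p : ∀ {p q : Subset n} → p ⊆ q → p ∩ q ≡ p
  p⊆q⇒p∩q≡p {p} {q} p⊆q = ⊆-antisym (p∩q⊆p p q) (λ x∈p → x∈p∩q⁺ (x∈p , p⊆q x∈p))

  p⊆q⇒q∩p≡p : ∀ {p q : Subset n} → p ⊆ q → q ∩ p ≡ p
  p⊆q⇒q∩p≡p {p} {q} p⊆q = ⊆-antisym (p∩q⊆q q p) (λ x∈p → x∈p∩q⁺ (p⊆q x∈p , x∈p))

  p⊆q⇒p∪q≡q : ∀ {p q : Subset n} → p ⊆ q → p ∪ q ≡ q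
  p⊆q⇒p∪q≡q {p} {q} p⊆q = ⊆-antisym ([ p⊆q , (λ x∈q → x∈q) ]′ ∘ x∈p∪q⁻ p q) (q⊆p∪q p q)

  p⊆q⇒q∪p≡q : ∀ {p q : Subset n} → p ⊆ q → q ∪ p ≡ q
  p⊆q⇒q∪p≡q {p} {q} p⊆q = ⊆-antisym ([ (λ x∈q → x∈q) , p⊆q ]′ ∘ x∈p∪q⁻ q p) (p⊆p∪q p)

  -- Antitonicity is asked only for nonempty `T`, because the value 0 at the empty set can break it;
  -- hence the split on whether the two differences are empty.
  antitone⇒WeaklySupermodular : ∀ (f : Subset n → ℕ ⁺) →
    (∀ {S T} → T ⊆ S → Nonempty T → f S ≤⁺ f T) → WeaklySupermodular f
  antitone⇒WeaklySupermodular f anti A B with nonempty? (A ─ B) | nonempty? (B ─ A)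
  ... | yes A─B≢∅ | yes B─A≢∅ = ≤⁺-trans ≤-trans
    (+⁺-mono-≤⁺ (anti (p─q⊆p A B) A─B≢∅) (anti (p─q⊆p B A) B─A≢∅))
    (y≤x⊔⁺y (f (A ∩ B) +⁺ f (A ∪ B)) _)
  ... | no A─B≡∅ | _
    rewrite p⊆q⇒p∩q≡p (Empty-─⇒⊆ A─B≡∅) | p⊆q⇒p∪q≡q (Empty-─⇒⊆ A─B≡∅) = x≤x⊔⁺y _ _
  -- Here `B ⊆ A`, so intersection and union are `B` and `A`, in the opposite order to the sum on
  -- the left.
  ... | yes _ | no B─A≡∅
    rewrite p⊆q⇒q∩p≡p (Empty-─⇒⊆ B─A≡∅) | p⊆q⇒q∪p≡q (Empty-─⇒⊆ B─A≡∅)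
          | +⁺-comm (f A) (f B) = x≤x⊔⁺y _ _

-- Cuts and components

module _ (G : Graph) where
  open Graph G

  Joins : Fin m → Fin n → Fin n → Set
  Joins e u v = ends e ≡ (u , v) ⊎ ends e ≡ (v , u)

  ∈-δ⁺ : ∀ S {e u v} → u ∈ S → v ∉ S → Joins e u v → e ∈ δ G S
  ∈-δ⁺ S {e} u∈S v∉S joins = lookup⇒[]= e _ (trans (lookup∘tabulate _ e) (crossing joins))
    where
    crossing : Joins e _ _ → lookup S (proj₁ (ends e)) xor lookup S (proj₂ (ends e)) ≡ true
    crossing (inj₁ eq) rewrite eq | []=⇒lookup u∈S | ∉⇒lookup≡outside v∉S = refl
    crossing (inj₂ eq) rewrite eq | []=⇒lookup u∈S | ∉⇒lookup≡outside v∉S = refl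

  ∈-δ⁻ : ∀ S {e} → e ∈ δ G S → ∃[ u ] ∃[ v ] (u ∈ S × v ∉ S × Joins e u v)
  ∈-δ⁻ S {e} e∈δ
    with lookup S (proj₁ (ends e)) in eq₁ | lookup S (proj₂ (ends e)) in eq₂
       | trans (sym (lookup∘tabulate _ e)) ([]=⇒lookup e∈δ)
  ... | true  | false | _  = _ , _ , lookup⇒[]= _ S eq₁ , lookup≡outside⇒∉ eq₂ , inj₁ refl
  ... | false | true  | _  = _ , _ , lookup⇒[]= _ S eq₂ , lookup≡outside⇒∉ eq₁ , inj₂ refl
  ... | true  | true  | ()
  ... | false | false | ()

  -- That is, `S` is a union of components of the graph with edge set `Z`.
  Closed : EdgeSet → VertexSet → Set
  Closed Z S = Empty (δ[_] G Z S)

  Connected-mono : ∀ {Z Z′ u v} → Z ⊆ Z′ → Connected G Z u v → Connected G Z′ u v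
  Connected-mono Z⊆Z′ = Star.map λ (e , e∈Z , joins) → e , Z⊆Z′ e∈Z , joins

  Closed⇒Connected-∈ : ∀ {Z} S {u v} → Closed Z S → u ∈ S → Connected G Z u v → v ∈ S
  Closed⇒Connected-∈ S closed u∈S ε = u∈S
  Closed⇒Connected-∈ S closed u∈S (_◅_ {j = w} (e , e∈Z , joins) walk) with w ∈? S
  ... | yes w∈S = Closed⇒Connected-∈ S closed w∈S walk
  ... | no  w∉S = contradiction (e , x∈p∩q⁺ (∈-δ⁺ S u∈S w∉S joins , e∈Z)) closed

  IsComponent⇒Nonempty : ∀ {Z S} → IsComponent G Z S → Nonempty S
  IsComponent⇒Nonempty (u , class) = u , from (class u) ε

  IsComponent⇒Closed : ∀ {Z S} → IsComponent G Z S → Closed Z S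
  IsComponent⇒Closed {Z} {S} (u , class) (e , e∈) with x∈p∩q⁻ (δ G S) Z e∈
  ... | e∈δ , e∈Z with ∈-δ⁻ S e∈δ
  ...   | x , y , x∈S , y∉S , joins =
    y∉S (from (class y) (to (class x) x∈S ◅◅ (e , e∈Z , joins) ◅ ε))

  -- Reachability is not given as decidable, so the class is built by growing a set from `u`: an
  -- edge of `Z` leaving `T` adds its outer end, and once none is left `T` contains everything
  -- reachable. Strict growth within a finite vertex set must stop.
  component : ∀ Z u → ∃[ T ] (∀ v → v ∈ T ⇔ Connected G Z u v)
  component Z u = grow ⁅ u ⁆ (⊃-wellFounded _) (x∈⁅x⁆ u) λ v∈ → reflexive (x∈⁅y⁆⇒x≡y u v∈)
    where
    reflexive : ∀ {v} → v ≡ u → Connected G Z u v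
    reflexive refl = ε

    grow : ∀ T → Acc _⊃_ T → u ∈ T → (∀ {v} → v ∈ T → Connected G Z u v) →
           ∃[ T ] (∀ v → v ∈ T ⇔ Connected G Z u v)
    grow T (acc rec) u∈T reach with nonempty? (δ[_] G Z T)
    ... | no  closed   = T , λ v → mk⇔ reach (Closed⇒Connected-∈ T closed u∈T)
    ... | yes (e , e∈) with x∈p∩q⁻ (δ G T) Z e∈
    ...   | e∈δ , e∈Z with ∈-δ⁻ T e∈δ
    ...     | x , y , x∈T , y∉T , joins =
      grow (T ∪ ⁅ y ⁆) (rec (p⊆p∪q _ , y , q⊆p∪q T _ (x∈⁅x⁆ y) , y∉T)) (p⊆p∪q _ u∈T)
           ([ reach , reach-new ∘ x∈⁅y⁆⇒x≡y y ]′ ∘ x∈p∪q⁻ T _)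
      where
      reach-new : ∀ {v} → v ≡ y → Connected G Z u v
      reach-new refl = reach x∈T ◅◅ (e , e∈Z , joins) ◅ ε

  -- Fault sets and the base cut requirement

  module _ {τ : ℕ → ℕ} (τ-anti : ∀ k ℓ → k ≤ ℓ → τ ℓ ≤ τ k)
           {π : VertexSet → ℝ} (π-mono : ∀ T S → T ⊆ S → π T ≤ℝ π S)
           {f : VertexSet → ℕ ⁺} (base : IsBaseCutRequirement τ π f) where
    open IsBaseCutRequirement base

    f-anti : ∀ {S T} → T ⊆ S → Nonempty T → f S ≤⁺ f T
    f-anti {S} {T} T⊆S T≢∅@(x , x∈T) =
      IsMin-anti (λ {ℓ} τ<π → <-≤ℝ-trans (fromℕ (τ ℓ)) (π T) (π S) τ<π (π-mono T S T⊆S))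
                 (at-nonempty S (x , T⊆S x∈T)) (at-nonempty T T≢∅)

    -- As `τ` is non-increasing, the set whose minimum is `f S` is upward closed, so `f S` at most
    -- `ℓ` would put `ℓ` in it. The negated `≤⁺` stands for `f S > ℓ` and covers `f S = ⊤⁺`.
    π≤τ⇒f≰ : ∀ {S ℓ} → Nonempty S → π S ≤ℝ fromℕ (τ ℓ) → ¬ f S ≤⁺ [ ℓ ]
    π≤τ⇒f≰ {S} {ℓ} S≢∅ π≤τ f≤ℓ = ≤ℝ⇒≯ℝ (π S) (fromℕ (τ ℓ)) π≤τ
      (IsMin-≤⁻ (λ j≤k → fromℕ-≤-<ℝ-trans (π S) (τ-anti _ _ j≤k)) (at-nonempty S S≢∅) f≤ℓ)

    f≰⇒π≤τ : ∀ {S ℓ} → Nonempty S → ¬ f S ≤⁺ [ ℓ ] → π S ≤ℝ fromℕ (τ ℓ)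
    f≰⇒π≤τ {S} {ℓ} S≢∅ f≰ℓ =
      ≯ℝ⇒≤ℝ (π S) (fromℕ (τ ℓ)) (f≰ℓ ∘ IsMin-≤ (at-nonempty S S≢∅))

    module _ {H : EdgeSet} where

      H─F⊆⊤─F : ∀ F → H ─ F ⊆ ⊤ ─ F
      H─F⊆⊤─F F = ─-monoˡ-⊆ F (λ _ → ∈⊤)

      Closed⇒δ⊆ : ∀ F S → Closed (H ─ F) S → δ[_] G H S ⊆ F
      Closed⇒δ⊆ F S closed {e} e∈ with e ∈? F | x∈p∩q⁻ (δ G S) H e∈
      ... | yes e∈F | _         = e∈F
      ... | no  e∉F | e∈δ , e∈H =
        contradiction (e , x∈p∩q⁺ (e∈δ , x∈p∧x∉q⇒x∈p─q e∈H e∉F)) closed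

      Feasible⇒Closed : Feasible G f H → ∀ {F S} → Nonempty S → π S ≤ℝ fromℕ (τ ∣ F ∣) →
                        Closed (H ─ F) S → Closed (⊤ ─ F) S
      Feasible⇒Closed feasible {F} {S} S≢∅ π≤τ closed (e , e∈)
        with x∈p∩q⁻ (δ G S) _ e∈ | ⊓⁺-sel (f S) [ ∣ δ G S ∣ ] | feasible S
      ... | e∈δ , e∈⊤─F | inj₁ eq | cut rewrite eq =
        π≤τ⇒f≰ S≢∅ π≤τ (≤⁺-trans ≤-trans cut [ p⊆q⇒∣p∣≤∣q∣ (Closed⇒δ⊆ F S closed) ])
      -- Now the cut of `S` in `H` has at least as many edges as its cut in `G`, so the two agree
      -- and lie in `F`, which `e` avoids.
      ... | e∈δ , e∈⊤─F | inj₂ eq | cut rewrite eq with [ ∣δ∣≤∣δH∣ ] ← cut =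
        x∈p─q⇒x∉q ⊤ F e∈⊤─F (Closed⇒δ⊆ F S closed (p⊆q∧∣q∣≤∣p∣⇒q⊆p (p∩q⊆p (δ G S) H) ∣δ∣≤∣δH∣ e∈δ))

      Feasible⇒components : Feasible G f H → ∀ F S → π S ≤ℝ fromℕ (τ ∣ F ∣) →
        IsComponent G (⊤ ─ F) S ⇔ IsComponent G (H ─ F) S
      Feasible⇒components feasible F S π≤τ = mk⇔ restrict extend
        where
        restrict : IsComponent G (⊤ ─ F) S → IsComponent G (H ─ F) S
        -- `T` is the component of `H ─ F` at `u`. It lies in `S`, so monotonicity of `π` carries
        -- the hypothesis over to it; then `T` is closed in `⊤ ─ F` too, and since it contains `u`
        -- it contains all of `S`.
        restrict (u , S-class) with component (H ─ F) u
        ... | T , T-class = u , λ v → mk⇔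
          (to (T-class v) ∘ Closed⇒Connected-∈ T T-closed u∈T ∘ to (S-class v))
          (from (S-class v) ∘ Connected-mono (H─F⊆⊤─F F))
          where
          u∈T : u ∈ T
          u∈T = from (T-class u) ε

          T⊆S : T ⊆ S
          T⊆S {v} = from (S-class v) ∘ Connected-mono (H─F⊆⊤─F F) ∘ to (T-class v)

          T-closed : Closed (⊤ ─ F) T
          T-closed = Feasible⇒Closed feasible (u , u∈T)
            (≤ℝ-trans (π T) (π S) (fromℕ (τ ∣ F ∣)) (π-mono T S T⊆S) π≤τ)
            (IsComponent⇒Closed (u , T-class))

        extend : IsComponent G (H ─ F) S → IsComponent G (⊤ ─ F) S
        extend comp@(u , class) = u , λ v → mk⇔
          (Connected-mono (H─F⊆⊤─F F) ∘ to (class v))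
          (Closed⇒Connected-∈ S closed (from (class u) ε))
          where
          closed : Closed (⊤ ─ F) S
          closed = Feasible⇒Closed feasible (IsComponent⇒Nonempty comp) π≤τ
                                   (IsComponent⇒Closed comp)

      components⇒Feasible :
        (∀ F S → π S ≤ℝ fromℕ (τ ∣ F ∣) → IsComponent G (⊤ ─ F) S ⇔ IsComponent G (H ─ F) S) →
        Feasible G f H
      components⇒Feasible same S with ≤⁺-dec _≤?_ (f S ⊓⁺ [ ∣ δ G S ∣ ]) [ ∣ δ[_] G H S ∣ ]
      ... | yes cut = cut
      -- Both terms of the minimum exceed the size of the cut in `H`: the term `∣ δ G S ∣` yields an
      -- edge of `G` outside that cut, and the term `f S` later yields the bound on `π`.
      ... | no  violated
        with ∣p∣≰∣q∣⇒Nonempty-─ (violated ∘ ≤⁺-trans ≤-trans (x⊓⁺y≤y (f S) _) ∘ [_])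
      ...   | e , e∈ with ∈-δ⁻ S (p─q⊆p (δ G S) _ e∈)
      -- `S` itself may be disconnected in `H ─ F`, so the contradiction comes from the component
      -- `T` of the end `x`: `e` leaves `T` because `y ∉ S` and `T ⊆ S`.
      ...     | x , y , x∈S , y∉S , joins with component (H ─ δ[_] G H S) x
      ...       | T , T-class = contradiction
        (e , x∈p∩q⁺ (∈-δ⁺ T (from (T-class x) ε) (y∉S ∘ T⊆S) joins , x∈p∧x∉q⇒x∈p─q ∈⊤ e∉F))
        (IsComponent⇒Closed (from (same F T π≤τ) (x , T-class)))
        where
        F : EdgeSet
        F = δ[_] G H S

        e∉F : e ∉ F
        e∉F = x∈p─q⇒x∉q (δ G S) F e∈

        S-closed : Closed (H ─ F) S
        S-closed (d , d∈) with x∈p∩q⁻ (δ G S) _ d∈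
        ... | d∈δ , d∈H─F = x∈p─q⇒x∉q H F d∈H─F (x∈p∩q⁺ (d∈δ , p─q⊆p H F d∈H─F))

        T⊆S : T ⊆ S
        T⊆S {v} = Closed⇒Connected-∈ S S-closed x∈S ∘ to (T-class v)

        π≤τ : π T ≤ℝ fromℕ (τ ∣ F ∣)
        π≤τ = ≤ℝ-trans (π T) (π S) (fromℕ (τ ∣ F ∣)) (π-mono T S T⊆S)
          (f≰⇒π≤τ (x , x∈S) (violated ∘ ≤⁺-trans ≤-trans (x⊓⁺y≤x (f S) _)))

theorem3p2 : (G : Graph) → let open Graph G in
    (τ : ℕ → ℕ) → (∀ k ℓ → k ≤ ℓ → τ ℓ ≤ τ k) →
    (π : VertexSet → ℝ) → (∀ S → fromℕ 0 ≤ℝ π S) →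
    (∀ T S → T ⊆ S → π T ≤ℝ π S) →
    (f : VertexSet → ℕ ⁺) → IsBaseCutRequirement τ π f →
    WeaklySupermodular f ×
    (∀ (H : EdgeSet) →
    Feasible G f H ⇔
    (∀ (F : EdgeSet) (S : VertexSet) → π S ≤ℝ fromℕ (τ ∣ F ∣) →
    IsComponent G (⊤ ─ F) S ⇔ IsComponent G (H ─ F) S))
theorem3p2 G τ τ-anti π _ π-mono f base =
  antitone⇒WeaklySupermodular f (f-anti G τ-anti π-mono base) ,
  λ H → mk⇔ (Feasible⇒components G τ-anti π-mono base)
            (components⇒Feasible G τ-anti π-mono base)
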